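{- Let $M$ be a multi-path matroid and $\sigma$ a cyclic permutation of its ground set, and let $\mathcal{I}$ be a minimal $\sigma$-interval presentation of $M$. Then every set in $\mathcal{I}$ is a cocircuit of $M$. Consequently, every minimal $\sigma$-interval presentation of a multi-path matroid is a minimal presentation.
   Context: Transversal matroid $M[\mathcal{A}]$ of a multiset $\mathcal{A}=(A_1,\ldots,A_r)$ of subsets of a finite set $S$: its independent sets are the partial transversals. A presentation $(A_1,\ldots,A_r)$ of $M$ contains a presentation $(A'_1,\ldots,A'_r)$ of $M$ if $A'_i\subseteq A_i$ for all $i$; a presentation is minimal if it contains no other presentation of $M$. For a cyclic permutation $\sigma$ of $S$, a $\sigma$-interval is a nonempty set $\{f,\sigma(f),\ldots,l\}$; a $\sigma$-interval presentation is a presentation by an antichain (no member containing another) of $\sigma$-intervals, and it is a minimal $\sigma$-interval presentation if it contains no other $\sigma$-interval presentation of $M$. A multi-path matroid is a transversal matroid having a $\sigma$-interval presentation for some cyclic permutation $\sigma$ of its ground set. -}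

module Defs where

open import Data.Nat using (ℕ; zero; suc; _≤_; _<_)
open import Data.Fin using (Fin)
open import Data.Fin.Subset using (Subset; _∈_; _⊆_)
open import Data.Fin.Permutation using (Permutation′; _⟨$⟩ʳ_)
open import Data.Product using (Σ; ∃; ∃-syntax; _×_; _,_)
open import Function.Bundles using (_⇔_)
open import Relation.Binary.PropositionalEquality using (_≡_; _≢_)
open import Relation.Nullary using (¬_)
open import Level using (0ℓ)

-- Ground set S = Fin n; subsets of S are 'Subset n'.
-- A matroid is given by its family of independent sets.
IndepPred : ℕ → Set₁
IndepPred n = Subset n → Set

-- A multiset (A₁,…,A_r) of subsets of S, indexed by Fin r.
Family : ℕ → ℕ → Set
Family n r = Fin r → Subset n

PartialTransversal : ∀ {n r} → Family n r → Subset n → Set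
PartialTransversal {n} {r} A X =
  Σ ((x : Fin n) → x ∈ X → Fin r) λ φ →
    (∀ x y (px : x ∈ X) (py : y ∈ X) → φ x px ≡ φ y py → x ≡ y)
    × (∀ x (px : x ∈ X) → x ∈ A (φ x px))

IsPresentation : ∀ {n r} → IndepPred n → Family n r → Set
IsPresentation {n} M A = ∀ (X : Subset n) → (M X ⇔ PartialTransversal A X)

_Contains_ : ∀ {n r} → Family n r → Family n r → Set
A Contains A' = ∀ i → A' i ⊆ A i

IsMinimalPresentation : ∀ {n r} → IndepPred n → Family n r → Set
IsMinimalPresentation {n} {r} M A =
  IsPresentation M A ×
  (∀ (A' : Family n r) → IsPresentation M A' → A Contains A' → ∀ i → A' i ≡ A i)

iter : ∀ {n} → Permutation′ n → ℕ → Fin n → Fin n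
iter σ zero x = x
iter σ (suc j) x = σ ⟨$⟩ʳ (iter σ j x)

IsCyclic : ∀ {n} → Permutation′ n → Set
IsCyclic {n} σ = ∀ (x y : Fin n) → ∃[ j ] iter σ j x ≡ y

IsInterval : ∀ {n} → Permutation′ n → Subset n → Set
IsInterval {n} σ I =
  ∃[ f ] ∃[ k ] (k < n) ×
    (∀ (x : Fin n) → (x ∈ I ⇔ (∃[ j ] (j ≤ k) × (iter σ j f ≡ x))))

IsAntichain : ∀ {n r} → Family n r → Set
IsAntichain A = ∀ i j → i ≢ j → ¬ (A i ⊆ A j)

IsIntervalPresentation : ∀ {n r} → Permutation′ n → IndepPred n → Family n r → Set
IsIntervalPresentation σ M A =
  IsPresentation M A × (∀ i → IsInterval σ (A i)) × IsAntichain A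

IsMinimalIntervalPresentation : ∀ {n r} → Permutation′ n → IndepPred n → Family n r → Set
IsMinimalIntervalPresentation {n} {r} σ M A =
  IsIntervalPresentation σ M A ×
  (∀ (A' : Family n r) → IsIntervalPresentation σ M A' → A Contains A' → ∀ i → A' i ≡ A i)

IsMultiPath : ∀ {n} → IndepPred n → Set
IsMultiPath {n} M =
  ∃[ r ] Σ (Permutation′ n) λ σ → IsCyclic σ × Σ (Family n r) λ A → IsIntervalPresentation σ M A

IsBasis : ∀ {n} → IndepPred n → Subset n → Set
IsBasis {n} M B = M B × (∀ (X : Subset n) → M X → B ⊆ X → X ≡ B)

MeetsAllBases : ∀ {n} → IndepPred n → Subset n → Set
MeetsAllBases {n} M C = ∀ (B : Subset n) → IsBasis M B → ∃[ x ] (x ∈ C × x ∈ B)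

IsCocircuit : ∀ {n} → IndepPred n → Subset n → Set
IsCocircuit {n} M C =
  MeetsAllBases M C × (∀ (D : Subset n) → D ⊆ C → MeetsAllBases M D → D ≡ C)

{-# OPTIONS --safe #-}
module Submission where

-- If I i is not a cocircuit, then no system of distinct representatives (SDR) lets every
-- other set avoid I i. Take an SDR ψ with as few representatives in I i as possible, and
-- j ≢ i with ψ j ∈ I i. The interval I j is not within I i, so it contains an endpoint x of I i, and
-- ψ j may be chosen to be x. Deleting x from I i then keeps the presentation: if a
-- matching of X uses x for I i, an alternating path from x either rematches X without
-- that edge or improves ψ. The deletion may break the antichain condition, but only by
-- making the shortened interval a subset of one with the same end; deleting
-- that element from the larger one and iterating yields an antichain again,
-- contradicting minimality.

open import Defs
open import Data.Empty using (⊥; ⊥-elim)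
open import Data.Fin using (Fin; zero; suc)
open import Data.Fin.Permutation using (Permutation′; _⟨$⟩ʳ_; _⟨$⟩ˡ_; inverseˡ; flip)
open import Data.Fin.Permutation.Components using (transpose; transpose-inverse)
open import Data.Fin.Properties using (_≟_; any?; injective⇒≤)
open import Data.Fin.Subset using (Subset; ⊤; _∈_; _∉_; _⊆_; _⊂_; _-_; ∣_∣; ⁅_⁆; _∪_)
open import Data.Fin.Subset.Induction using (⊂-wellFounded)
open import Data.Fin.Subset.Properties
  using (_∈?_; _⊆?_; ∈⊤; ⊆-antisym; p─q⊆p; x∈p∧x≢y⇒x∈p-y; x∈p⇒p-x⊂p; x∈p⇒∣p-x∣<∣p∣;
         p⊆q⇒∣p∣≤∣q∣; x∈⁅x⁆; x∈⁅y⁆⇒x≡y; p⊆p∪q; q⊆p∪q; x∈p∪q⁻)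
open import Data.Nat as ℕ using (ℕ; _+_; _∸_; _≤_; _<_; z≤n; s≤s)
open import Data.Nat.Induction using (<-wellFounded)
open import Data.Nat.Properties
  using (≤-refl; ≤-trans; ≤-total; m∸n≤m; m∸[m∸n]≡n; +-∸-assoc; n≤1+n; 1+n≰n;
         +-mono-≤; +-mono-<-≤; +-mono-≤-<; m≤n⇒m<n∨m≡n; <⇒≤)
open import Data.Product using (∃; ∃-syntax; _×_; _,_; proj₁; proj₂)
open import Data.Sum using (_⊎_; inj₁; inj₂)
open import Data.Vec using (_∷_; there; tabulate)
open import Data.Vec.Properties using (lookup∘tabulate; lookup⇒[]=; []=⇒lookup)
open import Data.Vec.Functional as Vector using (Vector; updateAt)
open import Data.Vec.Functional.Properties using (updateAt-updates; updateAt-minimal)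
open import Function using (_∘_; const)
open import Function.Bundles using (_⇔_; mk⇔; Equivalence)
open import Function.Definitions using (Injective)
open import Induction.WellFounded using (Acc; acc)
open import Relation.Binary.PropositionalEquality
  using (_≡_; _≢_; refl; sym; trans; cong; subst; ≢-sym)
open import Relation.Nullary using (¬_; Dec; yes; no; does; contradiction)
open import Relation.Nullary.Decidable using (_×-dec_; ¬?; dec-true; decidable-stable)
open Equivalence using (to; from)

private
  variable
    n r : ℕ

-- Finite functions and subsets

-- `P` may contain hypotheses on the index and on the value, so one application carries a whole
-- implication through the update.
updateAt-elim : ∀ {a p} {A : Set a} (P : Fin n → A → Set p) (xs : Vector A n) (i : Fin n) {f : A → A} →
                P i (f (xs i)) → (∀ k → k ≢ i → P k (xs k)) → ∀ k → P k (updateAt xs i f k)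
updateAt-elim P xs i {f} Pi Pk k with k ≟ i
... | yes refl = subst (P k) (sym (updateAt-updates k xs)) Pi
... | no  k≢i  = subst (P k) (sym (updateAt-minimal k i xs k≢i)) (Pk k k≢i)

transpose-elim : ∀ {p} (P : Fin n → Fin n → Set p) (i j : Fin n) →
                 P i j → (j ≢ i → P j i) → (∀ k → k ≢ i → k ≢ j → P k k) → ∀ k → P k (transpose i j k)
transpose-elim P i j Pi Pj Pk k with k ≟ i
... | yes refl = Pi
... | no  k≢i with k ≟ j
...   | yes refl = Pj k≢i
...   | no  k≢j  = Pk k k≢i k≢j

transpose-injective : (i j : Fin n) → Injective _≡_ _≡_ (transpose i j)
transpose-injective i j {x} {y} eq =
  trans (sym (transpose-inverse j i)) (trans (cong (transpose j i) eq) (transpose-inverse j i))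

∷-injective : ∀ {a} {A : Set a} {y : A} {g : Fin n → A} →
              (∀ k → g k ≢ y) → Injective _≡_ _≡_ g → Injective _≡_ _≡_ (y Vector.∷ g)
∷-injective g≢y inj {zero}  {zero}  eq = refl
∷-injective g≢y inj {zero}  {suc l} eq = contradiction (sym eq) (g≢y l)
∷-injective g≢y inj {suc k} {zero}  eq = contradiction eq (g≢y k)
∷-injective g≢y inj {suc k} {suc l} eq = cong suc (inj eq)

sum : Vector ℕ r → ℕ
sum = Vector.foldr _+_ 0

sum-mono-≤ : (f g : Vector ℕ r) → (∀ k → f k ≤ g k) → sum f ≤ sum g
sum-mono-≤ {ℕ.zero}  f g f≤g = z≤n
sum-mono-≤ {ℕ.suc r} f g f≤g = +-mono-≤ (f≤g zero) (sum-mono-≤ (f ∘ suc) (g ∘ suc) (f≤g ∘ suc))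

sum-mono-< : (f g : Vector ℕ r) → (∀ k → f k ≤ g k) → ∀ i → f i < g i → sum f < sum g
sum-mono-< f g f≤g zero    fi<gi = +-mono-<-≤ fi<gi (sum-mono-≤ (f ∘ suc) (g ∘ suc) (f≤g ∘ suc))
sum-mono-< f g f≤g (suc i) fi<gi = +-mono-≤-< (f≤g zero) (sum-mono-< (f ∘ suc) (g ∘ suc) (f≤g ∘ suc) i fi<gi)

x∉p-x : (p : Subset n) (x : Fin n) → x ∉ p - x
x∉p-x (s ∷ p) (suc x) (there x∈p-x) = x∉p-x p x x∈p-x

p-x⊆p : (p : Subset n) (x : Fin n) → p - x ⊆ p
p-x⊆p p x = p─q⊆p p ⁅ x ⁆

⊈⇒∃ : (p q : Subset n) → ¬ (p ⊆ q) → ∃[ z ] (z ∈ p × z ∉ q)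
⊈⇒∃ p q p⊈q with any? (λ z → (z ∈? p) ×-dec ¬? (z ∈? q))
... | yes found = found
... | no  none  = contradiction (λ {z} z∈p → decidable-stable (z ∈? q) (λ z∉q → none (z , z∈p , z∉q))) p⊈q

image : (Fin r → Fin n) → Subset n
image ψ = tabulate (λ v → does (any? (λ k → ψ k ≟ v)))

∈-image⁺ : (ψ : Fin r → Fin n) (k : Fin r) → ψ k ∈ image ψ
∈-image⁺ ψ k = lookup⇒[]= (ψ k) (image ψ)
  (trans (lookup∘tabulate _ (ψ k)) (dec-true (any? (λ l → ψ l ≟ ψ k)) (k , refl)))

∈-image⁻ : (ψ : Fin r → Fin n) {v : Fin n} → v ∈ image ψ → ∃[ k ] ψ k ≡ v
∈-image⁻ ψ {v} v∈ with any? (λ k → ψ k ≟ v) | trans (sym (lookup∘tabulate (λ v → does (any? (λ k → ψ k ≟ v))) v)) ([]=⇒lookup v∈)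
... | yes found | _  = found
... | no  _     | ()

-- Intervals

StartsAt : Permutation′ n → Subset n → Fin n → Set
StartsAt {n} τ B f = ∃[ k ] (k < n) × (∀ x → (x ∈ B ⇔ (∃[ j ] (j ≤ k) × (iter τ j f ≡ x))))

iter-suc : (τ : Permutation′ n) (j : ℕ) (x : Fin n) → iter τ j (τ ⟨$⟩ʳ x) ≡ τ ⟨$⟩ʳ (iter τ j x)
iter-suc τ ℕ.zero    x = refl
iter-suc τ (ℕ.suc j) x = cong (τ ⟨$⟩ʳ_) (iter-suc τ j x)

perm-injective : (τ : Permutation′ n) {x y : Fin n} → τ ⟨$⟩ʳ x ≡ τ ⟨$⟩ʳ y → x ≡ y
perm-injective τ eq = trans (sym (inverseˡ τ)) (trans (cong (τ ⟨$⟩ˡ_) eq) (inverseˡ τ))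

-- If `τ p` were reached from the first element in at least one step, the element one step earlier,
-- which is `p`, would also lie in `B`.
startsAt-entry : (τ : Permutation′ n) (B : Subset n) {p : Fin n} → IsInterval τ B →
                 p ∉ B → τ ⟨$⟩ʳ p ∈ B → StartsAt τ B (τ ⟨$⟩ʳ p)
startsAt-entry τ B (f , k , k<n , h) p∉B τp∈B with to (h _) τp∈B
... | ℕ.zero  , _   , refl = k , k<n , h
... | ℕ.suc j , j≤k , eq   = contradiction (from (h _) (j , <⇒≤ j≤k , perm-injective τ eq)) p∉B

startsAt-nested : (τ : Permutation′ n) (B B' : Subset n) {f : Fin n} →
                  StartsAt τ B f → StartsAt τ B' f → B ⊆ B' ⊎ B' ⊆ B
startsAt-nested τ B B' (k , _ , h) (k' , _ , h') with ≤-total k k'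
... | inj₁ k≤k' = inj₁ λ {x} x∈B → let (j , j≤k , eq) = to (h x) x∈B in from (h' x) (j , ≤-trans j≤k k≤k' , eq)
... | inj₂ k'≤k = inj₂ λ {x} x∈B' → let (j , j≤k' , eq) = to (h' x) x∈B' in from (h x) (j , ≤-trans j≤k' k'≤k , eq)

start∈ : (τ : Permutation′ n) (B : Subset n) {f : Fin n} → StartsAt τ B f → f ∈ B
start∈ τ B (k , _ , h) = from (h _) (0 , z≤n , refl)

-- Since `p` is outside, the walk through `B` never returns to its start `τ p`: the step before the
-- return would be at `p`. So `τ p` occurs only at position 0, and the positions from 1 on give the
-- shortened interval.
interval-removeStart : (τ : Permutation′ n) (B : Subset n) {p : Fin n} → IsInterval τ B →
                       p ∉ B → τ ⟨$⟩ʳ p ∈ B → ¬ (∀ w → w ∈ B → w ≡ τ ⟨$⟩ʳ p) →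
                       StartsAt τ (B - (τ ⟨$⟩ʳ p)) (τ ⟨$⟩ʳ (τ ⟨$⟩ʳ p))
interval-removeStart {n} τ B {p} iv p∉B τp∈B B≢⁅τp⁆ with startsAt-entry τ B iv p∉B τp∈B
... | ℕ.zero  , _     , h = contradiction singleton B≢⁅τp⁆
  where
  singleton : ∀ w → w ∈ B → w ≡ τ ⟨$⟩ʳ p
  singleton w w∈B with to (h w) w∈B
  ... | ℕ.zero , z≤n , eq = sym eq
... | ℕ.suc k , k+1<n , h = k , <⇒≤ k+1<n , λ x → mk⇔ (⇒ x) (⇐ x)
  where
  f = τ ⟨$⟩ʳ p
  ⇒ : ∀ x → x ∈ B - f → ∃[ j ] (j ≤ k) × (iter τ j (τ ⟨$⟩ʳ f) ≡ x)
  ⇒ x x∈ with to (h x) (p-x⊆p B f x∈)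
  ... | ℕ.zero  , _       , refl = contradiction x∈ (x∉p-x B f)
  ... | ℕ.suc j , s≤s j≤k , eq   = j , j≤k , trans (iter-suc τ j f) eq
  ⇐ : ∀ x → ∃[ j ] (j ≤ k) × (iter τ j (τ ⟨$⟩ʳ f) ≡ x) → x ∈ B - f
  ⇐ x (j , j≤k , eq) = x∈p∧x≢y⇒x∈p-y (from (h x) (ℕ.suc j , s≤s j≤k , eq')) λ x≡f →
      p∉B (from (h p) (j , ≤-trans j≤k (n≤1+n k) , perm-injective τ (trans eq' x≡f)))
    where eq' = trans (sym (iter-suc τ j f)) eq

iter-flip : (σ : Permutation′ n) (a b : ℕ) (f : Fin n) → a ≤ b → iter (flip σ) a (iter σ b f) ≡ iter σ (b ∸ a) f
iter-flip σ ℕ.zero    b f _   = refl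
iter-flip σ (ℕ.suc a) b f a<b = trans (cong (σ ⟨$⟩ˡ_)
  (trans (iter-flip σ a b f (<⇒≤ a<b)) (cong (λ m → iter σ m f) (+-∸-assoc 1 a<b)))) (inverseˡ σ)

-- Read backwards from its last element `iter σ k f`, the interval has position `j` at `k ∸ j`.
-- Facts about first elements thus also serve for last elements.
interval-flip : (σ : Permutation′ n) (B : Subset n) → IsInterval σ B → IsInterval (flip σ) B
interval-flip σ B (f , k , k<n , h) = iter σ k f , k , k<n , λ x → mk⇔
  (λ x∈B → let (j , j≤k , eq) = to (h x) x∈B in
    k ∸ j , m∸n≤m k j ,
    trans (iter-flip σ (k ∸ j) k f (m∸n≤m k j)) (trans (cong (λ m → iter σ m f) (m∸[m∸n]≡n j≤k)) eq))
  (λ (a , a≤k , eq) → from (h x) (k ∸ a , m∸n≤m k a , trans (sym (iter-flip σ a k f a≤k)) eq))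

-- A discrete intermediate value property, used to locate where an interval enters or leaves another
-- set.
constant-or-changes : ∀ {p} {P : ℕ → Set p} → (∀ j → Dec (P j)) → ∀ k →
  (∀ j → j ≤ k → P j) ⊎ (∀ j → j ≤ k → ¬ P j) ⊎
  (∃[ m ] (m < k) × ((¬ P m × P (ℕ.suc m)) ⊎ (P m × ¬ P (ℕ.suc m))))
constant-or-changes P? ℕ.zero with P? 0
... | yes p = inj₁ λ { _ z≤n → p }
... | no ¬p = inj₂ (inj₁ λ { _ z≤n → ¬p })
constant-or-changes P? (ℕ.suc k) with constant-or-changes P? k | P? (ℕ.suc k)
... | inj₂ (inj₂ (m , m<k , c)) | _ = inj₂ (inj₂ (m , ≤-trans m<k (n≤1+n k) , c))
... | inj₁ all | no ¬p = inj₂ (inj₂ (k , ≤-refl , inj₂ (all k ≤-refl , ¬p)))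
... | inj₂ (inj₁ none) | yes p = inj₂ (inj₂ (k , ≤-refl , inj₁ (none k ≤-refl , p)))
... | inj₁ all | yes p = inj₁ λ j j≤ → extend j (m≤n⇒m<n∨m≡n j≤)
  where
  extend : ∀ j → j < ℕ.suc k ⊎ j ≡ ℕ.suc k → _
  extend j (inj₁ (s≤s j≤k)) = all j j≤k
  extend j (inj₂ refl)      = p
... | inj₂ (inj₁ none) | no ¬p = inj₂ (inj₁ λ j j≤ → extend j (m≤n⇒m<n∨m≡n j≤))
  where
  extend : ∀ j → j < ℕ.suc k ⊎ j ≡ ℕ.suc k → ¬ _
  extend j (inj₁ (s≤s j≤k)) = none j j≤k
  extend j (inj₂ refl)      = ¬p

-- Along `B`, membership in `C` changes between two consecutive elements. The one outside `C` is
-- `p`; its neighbour in `C` follows or precedes it according to the direction of the change.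
interval-crossing : (σ : Permutation′ n) (B C : Subset n) → IsInterval σ B → {y z : Fin n} →
  y ∈ B → y ∈ C → z ∈ B → z ∉ C →
  ∃[ p ] p ∉ C × ((σ ⟨$⟩ʳ p ∈ B × σ ⟨$⟩ʳ p ∈ C) ⊎ (σ ⟨$⟩ˡ p ∈ B × σ ⟨$⟩ˡ p ∈ C))
interval-crossing σ B C (f , k , k<n , h) {y} {z} y∈B y∈C z∈B z∉C
  with constant-or-changes (λ j → iter σ j f ∈? C) k
... | inj₁ all = let (j , j≤k , eq) = to (h z) z∈B in contradiction (subst (_∈ C) eq (all j j≤k)) z∉C
... | inj₂ (inj₁ none) = let (j , j≤k , eq) = to (h y) y∈B in contradiction (subst (_∈ C) (sym eq) y∈C) (none j j≤k)
... | inj₂ (inj₂ (m , m<k , inj₁ (∉C , ∈C))) =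
  iter σ m f , ∉C , inj₁ (from (h _) (ℕ.suc m , m<k , refl) , ∈C)
... | inj₂ (inj₂ (m , m<k , inj₂ (∈C , ∉C))) =
  iter σ (ℕ.suc m) f , ∉C ,
  inj₂ (from (h _) (m , <⇒≤ m<k , sym (inverseˡ σ)) , subst (_∈ C) (sym (inverseˡ σ)) ∈C)

-- Matchings and systems of distinct representatives

-- A total function replaces the proof-dependent one of `PartialTransversal`, so that a rematching
-- is a composition with a transposition. Values outside `X` are arbitrary.
Matching : Family n r → Subset n → (Fin n → Fin r) → Set
Matching A X φ = (∀ x y → x ∈ X → y ∈ X → φ x ≡ φ y → x ≡ y) × (∀ x → x ∈ X → x ∈ A (φ x))

matching⇒transversal : (A : Family n r) {X : Subset n} {φ : Fin n → Fin r} → Matching A X φ → PartialTransversal A X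
matching⇒transversal A {φ = φ} (inj , mem) = (λ x _ → φ x) , inj , mem

transversal⇒matching : (A : Family n r) {X : Subset n} → Fin r → PartialTransversal A X → ∃ (Matching A X)
transversal⇒matching A {X} i (φ , inj , mem) = φ' , inj' , mem'
  where
  φ' : _ → _
  φ' x with x ∈? X
  ... | yes x∈X = φ x x∈X
  ... | no  _   = i
  inj' : ∀ x y → x ∈ X → y ∈ X → φ' x ≡ φ' y → x ≡ y
  inj' x y x∈X y∈X with x ∈? X | y ∈? X
  ... | yes x∈X' | yes y∈X' = inj x y x∈X' y∈X'
  ... | no  x∉X  | _        = contradiction x∈X x∉X
  ... | yes _    | no y∉X   = contradiction y∈X y∉X
  mem' : ∀ x → x ∈ X → x ∈ A (φ' x)
  mem' x x∈X with x ∈? X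
  ... | yes x∈X' = mem x x∈X'
  ... | no  x∉X  = contradiction x∈X x∉X

SDR : Family n r → (Fin r → Fin n) → Set
SDR A ψ = Injective _≡_ _≡_ ψ × (∀ k → ψ k ∈ A k)

updateAt-injective : {ψ : Fin r → Fin n} {j : Fin r} {z : Fin n} → Injective _≡_ _≡_ ψ →
                     (∀ k → k ≢ j → ψ k ≢ z) → Injective _≡_ _≡_ (updateAt ψ j (const z))
updateAt-injective {ψ = ψ} {j} {z} inj fresh {k} {l} =
  updateAt-elim (λ k v → v ≡ updateAt ψ j (const z) l → k ≡ l) ψ j
    (updateAt-elim (λ l v → z ≡ v → j ≡ l) ψ j (const refl) (λ l l≢j z≡ → contradiction (sym z≡) (fresh l l≢j)) l)
    (λ k k≢j → updateAt-elim (λ l v → ψ k ≡ v → k ≡ l) ψ j (λ ≡z → contradiction ≡z (fresh k k≢j)) (λ _ _ → inj) l)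
    k

updateAt-SDR : (A : Family n r) {ψ : Fin r → Fin n} {j : Fin r} {z : Fin n} → Injective _≡_ _≡_ ψ →
               (∀ k → k ≢ j → ψ k ∈ A k) → z ∈ A j → (∀ k → k ≢ j → ψ k ≢ z) →
               SDR A (updateAt ψ j (const z))
updateAt-SDR A {ψ} {j} inj mem z∈Aj fresh =
  updateAt-injective inj fresh , updateAt-elim (λ k v → v ∈ A k) ψ j z∈Aj mem

infix 4 _≼_
_≼_ : Family n r → Family n r → Set
A ≼ A' = ∀ X → PartialTransversal A X → PartialTransversal A' X

⊆⇒≼ : {A A' : Family n r} → A Contains A' → A' ≼ A
⊆⇒≼ A'⊆A X (φ , inj , mem) = φ , inj , λ x x∈X → A'⊆A _ (mem x x∈X)

delete : Family n r → Fin r → Fin n → Family n r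
delete A k x = updateAt A k (_- x)

delete⊆ : (A : Family n r) (k : Fin r) (x : Fin n) → A Contains delete A k x
delete⊆ A k x c {v} = updateAt-elim (λ c B → v ∈ B → v ∈ A c) A k (p-x⊆p (A k) x) (λ _ _ v∈ → v∈) c

∈-delete : (A : Family n r) (k : Fin r) {x v : Fin n} (c : Fin r) → v ∈ A c → (c ≡ k → v ≢ x) → v ∈ delete A k x c
∈-delete A k {x} {v} = updateAt-elim (λ c B → v ∈ A c → (c ≡ k → v ≢ x) → v ∈ B) A k
  (λ v∈ v≢x → x∈p∧x≢y⇒x∈p-y v∈ (v≢x refl)) (λ _ _ v∈ _ → v∈)

∉-delete : (A : Family n r) (k : Fin r) (x : Fin n) → x ∉ delete A k x k
∉-delete A k x = subst (x ∉_) (sym (updateAt-updates k A)) (x∉p-x (A k) x)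

delete-≡ : (A : Family n r) (k : Fin r) (x : Fin n) → delete A k x k ≡ A k - x
delete-≡ A k x = updateAt-updates k A

delete-≢ : (A : Family n r) (k : Fin r) (x : Fin n) {c : Fin r} → c ≢ k → delete A k x c ≡ A c
delete-≢ A k x {c} c≢k = updateAt-minimal c k A c≢k

-- If x is matched to A k, exchange the roles of j and k in the matching.
≼-delete-nested : (A : Family n r) {j k : Fin r} {x : Fin n} → j ≢ k → A j ⊆ A k → x ∈ A j → A ≼ delete A k x
≼-delete-nested A {j} {k} {x} j≢k Aj⊆Ak x∈Aj X pt with transversal⇒matching A j pt
... | φ , inj , mem with x ∈? X | φ x ≟ k
... | no x∉X | _ = matching⇒transversal (delete A k x) (inj , λ v v∈X → ∈-delete A k _ (mem v v∈X) λ _ v≡x → x∉X (subst (_∈ X) v≡x v∈X))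
... | yes _ | no φx≢k = matching⇒transversal (delete A k x) (inj , λ v v∈X → ∈-delete A k _ (mem v v∈X) λ φv≡k v≡x → φx≢k (trans (cong φ (sym v≡x)) φv≡k))
... | yes x∈X | yes φx≡k = matching⇒transversal (delete A k x) {φ = transpose j k ∘ φ}
  ( (λ v w v∈X w∈X eq → inj v w v∈X w∈X (transpose-injective j k eq))
  , λ v v∈X → transpose-elim (λ c d → φ v ≡ c → v ∈ delete A k x d) j k
      (λ φv≡j → ∈-delete A k k (Aj⊆Ak (subst (λ c → v ∈ A c) φv≡j (mem v v∈X)))
        λ _ v≡x → j≢k (trans (sym φv≡j) (trans (cong φ v≡x) φx≡k)))
      (λ _ φv≡k → ∈-delete A k j (subst (_∈ A j) (inj x v x∈X v∈X (trans φx≡k (sym φv≡k))) x∈Aj)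
        λ j≡k → contradiction j≡k j≢k)
      (λ c _ c≢k φv≡c → ∈-delete A k c (subst (λ c → v ∈ A c) φv≡c (mem v v∈X)) λ c≡k → contradiction c≡k c≢k)
      (φ v) refl )

-- Restoring the antichain condition

-- The termination measure of `restoreAntichain`.
size : Family n r → ℕ
size A = sum (∣_∣ ∘ A)

size-delete : (A : Family n r) (k : Fin r) {x : Fin n} → x ∈ A k → size (delete A k x) < size A
size-delete A k {x} x∈Ak = sum-mono-< (∣_∣ ∘ delete A k x) (∣_∣ ∘ A) (λ c → p⊆q⇒∣p∣≤∣q∣ (delete⊆ A k x c)) k
  (subst (λ B → ∣ B ∣ < ∣ A k ∣) (sym (delete-≡ A k x)) (x∈p⇒∣p-x∣<∣p∣ x∈Ak))

-- The state after the element p has been removed from the start of A j: only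
-- containments of A j in another interval, which then starts at τ p, can violate the
-- antichain condition.
record AlmostAntichain (τ : Permutation′ n) (A : Family n r) (j : Fin r) (p : Fin n) : Set where
  field
    interval   : ∀ k → IsInterval τ (A k)
    p∉Aj       : p ∉ A j
    τp∈Aj      : τ ⟨$⟩ʳ p ∈ A j
    others     : ∀ k m → k ≢ m → k ≢ j → m ≢ j → ¬ (A k ⊆ A m)
    notWithin  : ∀ k → k ≢ j → ¬ (A k ⊆ A j)
    p∉superset : ∀ k → k ≢ j → A j ⊆ A k → p ∉ A k

-- The superset `A k` contains `τ p` but not `p`, hence starts at `τ p`. Deleting this element moves
-- the defect from `j` to `k` and one position along `τ`.
restoreAntichain-step : (τ : Permutation′ n) (A : Family n r) {j k : Fin r} {p : Fin n} →
  AlmostAntichain τ A j p → k ≢ j → A j ⊆ A k → AlmostAntichain τ (delete A k (τ ⟨$⟩ʳ p)) k (τ ⟨$⟩ʳ p)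
restoreAntichain-step {n} τ A {j} {k} {p} st k≢j Aj⊆Ak = record
  { interval   = interval'
  ; p∉Aj       = ∉-delete A k x
  ; τp∈Aj      = subst (τ ⟨$⟩ʳ x ∈_) (sym (delete-≡ A k x)) (start∈ τ (A k - x) shrunk)
  ; others     = others'
  ; notWithin  = notWithin'
  ; p∉superset = p∉superset'
  }
  where
  open AlmostAntichain st
  x : Fin n
  x = τ ⟨$⟩ʳ p
  p∉Ak : p ∉ A k
  p∉Ak = p∉superset k k≢j Aj⊆Ak
  x∈Ak : x ∈ A k
  x∈Ak = Aj⊆Ak τp∈Aj
  shrunk : StartsAt τ (A k - x) (τ ⟨$⟩ʳ x)
  -- If `τ p` were the only element of `A k`, then `A k` would lie within `A j`.
  shrunk = interval-removeStart τ (A k) (interval k) p∉Ak x∈Ak λ single →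
    notWithin k k≢j λ {w} w∈Ak → subst (_∈ A j) (sym (single w w∈Ak)) τp∈Aj
  interval' : ∀ c → IsInterval τ (delete A k x c)
  interval' = updateAt-elim (λ _ → IsInterval τ) A k (_ , shrunk) (λ c _ → interval c)
  others' : ∀ c m → c ≢ m → c ≢ k → m ≢ k → ¬ (delete A k x c ⊆ delete A k x m)
  others' c m c≢m c≢k m≢k sub = go (c ≟ j) (m ≟ j)
    where
    Ac⊆Am : A c ⊆ A m
    Ac⊆Am {v} v∈ = subst (v ∈_) (delete-≢ A k x m≢k) (sub (subst (v ∈_) (sym (delete-≢ A k x c≢k)) v∈))
    go : Dec (c ≡ j) → Dec (m ≡ j) → ⊥
    go (no c≢j)   (no m≢j)   = others c m c≢m c≢j m≢j Ac⊆Am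
    go (no c≢j)   (yes refl) = notWithin c c≢j Ac⊆Am
    -- Two supersets of `A j` both start at `τ p`, so they are nested, which `others` forbids.
    go (yes refl) _ with startsAt-nested τ (A m) (A k)
        (startsAt-entry τ (A m) (interval m) (p∉superset m (≢-sym c≢m) Ac⊆Am) (Ac⊆Am τp∈Aj))
        (startsAt-entry τ (A k) (interval k) p∉Ak x∈Ak)
    ... | inj₁ Am⊆Ak = others m k m≢k (≢-sym c≢m) k≢j Am⊆Ak
    ... | inj₂ Ak⊆Am = others k m (≢-sym m≢k) k≢j (≢-sym c≢m) Ak⊆Am
  notWithin' : ∀ m → m ≢ k → ¬ (delete A k x m ⊆ delete A k x k)
  notWithin' m m≢k sub = go (m ≟ j)
    where
    Am⊆A'k : ∀ {v} → v ∈ A m → v ∈ delete A k x k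
    Am⊆A'k {v} v∈ = sub (subst (v ∈_) (sym (delete-≢ A k x m≢k)) v∈)
    go : Dec (m ≡ j) → ⊥
    go (yes refl) = ∉-delete A k x (Am⊆A'k τp∈Aj)
    go (no m≢j)   = others m k m≢k m≢j k≢j (λ v∈ → delete⊆ A k x k (Am⊆A'k v∈))
  p∉superset' : ∀ m → m ≢ k → delete A k x k ⊆ delete A k x m → x ∉ delete A k x m
  p∉superset' m m≢k sub x∈A'm = go (m ≟ j)
    where
    Ak⊆Am : A k ⊆ A m
    Ak⊆Am {v} v∈ with v ≟ x
    ... | yes refl = delete⊆ A k x m x∈A'm
    ... | no  v≢x  = delete⊆ A k x m (sub (∈-delete A k k v∈ (const v≢x)))
    go : Dec (m ≡ j) → ⊥
    go (yes refl) = notWithin k k≢j Ak⊆Am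
    go (no m≢j)   = others k m (≢-sym m≢k) k≢j m≢j Ak⊆Am

-- Each repair may create a new containment, so repairs are iterated; `≼-delete-nested` shows that
-- none of them loses an independent set.
restoreAntichain : (τ : Permutation′ n) (A : Family n r) → Acc _<_ (size A) → ∀ {j p} → AlmostAntichain τ A j p →
  ∃[ A' ] A Contains A' × A ≼ A' × (∀ k → IsInterval τ (A' k)) × IsAntichain A'
restoreAntichain τ A (acc rs) {j} {p} st with any? (λ k → ¬? (k ≟ j) ×-dec (A j ⊆? A k))
... | no none = A , (λ _ v∈ → v∈) , (λ _ pt → pt) , interval , antichain
  where
  open AlmostAntichain st
  antichain : IsAntichain A
  antichain k m k≢m sub with k ≟ j | m ≟ j
  ... | yes refl | _        = none (m , ≢-sym k≢m , sub)
  ... | no k≢j   | yes refl = notWithin k k≢j sub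
  ... | no k≢j   | no m≢j   = others k m k≢m k≢j m≢j sub
... | yes (k , k≢j , Aj⊆Ak) =
  let open AlmostAntichain st
      x = τ ⟨$⟩ʳ p
      (A' , sub , cov , rest) = restoreAntichain τ (delete A k x) (rs (size-delete A k (Aj⊆Ak τp∈Aj)))
                                  (restoreAntichain-step τ A st k≢j Aj⊆Ak)
  in A' , (λ c v∈ → delete⊆ A k x c (sub c v∈)) ,
     (λ X pt → cov X (≼-delete-nested A (≢-sym k≢j) Aj⊆Ak τp∈Aj X pt)) , rest

-- Removing an element from one set of a family

-- Two matchings, φ of X and χ of the indices, are modified along an alternating path
-- that starts at x. In φ the element u ∈ X is misplaced: it occupies i, which need not
-- contain it. In χ the index j is misplaced: it is assigned x. The index set U consists
-- of the indices that the path has not left yet.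
record Alternating (A : Family n r) (i : Fin r) (x : Fin n) (H : Subset r) (X : Subset n)
                   (U : Subset r) (φ : Fin n → Fin r) (χ : Fin r → Fin n) (j : Fin r) (u : Fin n) : Set where
  field
    φ-inj : ∀ v w → v ∈ X → w ∈ X → φ v ≡ φ w → v ≡ w
    φ-mem : ∀ v → v ∈ X → v ≢ u → v ∈ A (φ v)
    u∈X   : u ∈ X
    φu≡i  : φ u ≡ i
    u∈Aj  : u ∈ A j
    j≢i   : j ≢ i
    χ-inj : Injective _≡_ _≡_ χ
    χ-mem : ∀ k → k ≢ j → χ k ∈ A k
    χj≡x  : χ j ≡ x
    χ-H   : ∀ k → k ≢ j → χ k ∈ A i → k ∈ H
    j∈U   : j ∈ U
    left  : ∀ k → (k ∈ U → k ≡ j) → χ k ∈ X × (χ k ≡ u ⊎ φ (χ k) ∉ U)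

module _ (A : Family n r) (i : Fin r) (x : Fin n) (H : Subset r) (x∈Ai : x ∈ A i) (X : Subset n) where

  module _ {U φ χ j u} (st : Alternating A i x H X U φ χ j u) where
    open Alternating st

    occupied≢u : ∀ {z} → φ z ≡ j → z ≢ u
    occupied≢u φz≡j refl = j≢i (trans (sym φz≡j) φu≡i)

    only-u-at-i : ∀ {v} → v ∈ X → v ≢ u → φ v ≢ i
    only-u-at-i v∈X v≢u φv≡i = v≢u (φ-inj _ u v∈X u∈X (trans φv≡i (sym φu≡i)))

    -- Rematching by `transpose i j` sends `u` from `i` to `j`, where it is allowed, and an occupant
    -- of `j` to `i`; all other elements stay. The equations are oriented for `subst`.
    moved : ∀ {v} → v ∈ X → (v ≡ u → j ≡ transpose i j (φ v)) × (v ≢ u → φ v ≢ j → φ v ≡ transpose i j (φ v))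
    moved {v} v∈X =
      transpose-elim (λ c d → φ v ≡ c → (v ≡ u → j ≡ d) × (v ≢ u → c ≢ j → c ≡ d)) i j
        (λ φv≡i → (λ _ → refl) , λ v≢u _ → contradiction φv≡i (only-u-at-i v∈X v≢u))
        (λ _ φv≡j → (λ v≡u → contradiction v≡u (occupied≢u φv≡j)) , λ _ j≢j → contradiction refl j≢j)
        (λ c c≢i _ φv≡c → (λ { refl → contradiction (trans (sym φv≡c) φu≡i) c≢i }) , λ _ _ → refl)
        (φ v) refl

    moved-inj : ∀ v w → v ∈ X → w ∈ X → transpose i j (φ v) ≡ transpose i j (φ w) → v ≡ w
    moved-inj v w v∈X w∈X eq = φ-inj v w v∈X w∈X (transpose-injective i j eq)

    moved-mem : ∀ v → v ∈ X → φ v ≢ j → v ∈ A (transpose i j (φ v)) × transpose i j (φ v) ≢ i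
    moved-mem v v∈X φv≢j with v ≟ u
    ... | yes refl = subst (λ c → v ∈ A c × c ≢ i) (proj₁ (moved v∈X) refl) (u∈Aj , j≢i)
    ... | no v≢u   = subst (λ c → v ∈ A c × c ≢ i) (proj₂ (moved v∈X) v≢u φv≢j) (φ-mem v v∈X v≢u , only-u-at-i v∈X v≢u)

    moved-matching : (∀ z → z ∈ X → φ z ≡ j → z ∈ A i × z ≢ x) →
                     Matching (delete A i x) X (transpose i j ∘ φ)
    moved-matching h = moved-inj , mem
      where
      mem : ∀ v → v ∈ X → v ∈ delete A i x (transpose i j (φ v))
      mem v v∈X with φ v ≟ j
      ... | no φv≢j = let (v∈ , ≢i) = moved-mem v v∈X φv≢j in ∈-delete A i _ v∈ (λ ≡i → contradiction ≡i ≢i)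
      ... | yes φv≡j = subst (λ c → v ∈ delete A i x c) i≡
              (∈-delete A i i (proj₁ (h v v∈X φv≡j)) (const (proj₂ (h v v∈X φv≡j))))
        where
        i≡ : i ≡ transpose i j (φ v)
        i≡ = transpose-elim (λ c d → c ≡ j → i ≡ d) i j (λ eq → eq) (λ _ _ → refl) (λ _ _ c≢j c≡j → contradiction c≡j c≢j)
               (φ v) φv≡j

    -- As `χ j` is `x`, the invariant `left` at `j` says that `x` is `u`, which occupies `i`, or
    -- that `x` occupies an index outside `U`. Neither is `j`.
    occupier≢x : ∀ {z} → z ∈ X → φ z ≡ j → z ≢ x
    occupier≢x {z} z∈X φz≡j z≡x with proj₂ (left j (const refl))
    ... | inj₁ χj≡u = occupied≢u φz≡j (trans z≡x (trans (sym χj≡x) χj≡u))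
    ... | inj₂ ∉U   = ∉U (subst (_∈ U) (trans (sym φz≡j) (cong φ (trans z≡x (sym χj≡x)))) j∈U)

    -- The occupant `z` of `j` becomes the misplaced element at `i`. In `χ`, the index `j` takes `z`
    -- from `k`, and `k` receives `x` in return.
    advance : ∀ {z k} → z ∈ X → φ z ≡ j → z ∉ A i → χ k ≡ z →
              Alternating A i x H X (U - j) (transpose i j ∘ φ) (χ ∘ transpose j k) k z
    advance {z} {k} z∈X φz≡j z∉Ai χk≡z = record
      { φ-inj = moved-inj
      ; φ-mem = λ v v∈X v≢z → proj₁ (moved-mem v v∈X λ φv≡j → v≢z (φ-inj v z v∈X z∈X (trans φv≡j (sym φz≡j))))
      ; u∈X   = z∈X
      ; φu≡i  = transpose-elim (λ c d → c ≡ j → d ≡ i) i j sym (λ _ _ → refl) (λ _ _ c≢j c≡j → contradiction c≡j c≢j)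
                  (φ z) φz≡j
      ; u∈Aj  = subst (_∈ A k) χk≡z (χ-mem k k≢j)
      ; j≢i   = λ { refl → z∉Ai (subst (_∈ A k) χk≡z (χ-mem k k≢j)) }
      ; χ-inj = λ eq → transpose-injective j k (χ-inj eq)
      ; χ-mem = transpose-elim (λ c d → c ≢ k → χ d ∈ A c) j k
                  (λ _ → z∈Aj') (λ _ k≢k → contradiction refl k≢k) (λ c c≢j _ _ → χ-mem c c≢j)
      ; χj≡x  = transpose-elim (λ c d → c ≡ k → χ d ≡ x) j k
                  (λ j≡k → contradiction (sym j≡k) k≢j) (λ _ _ → χj≡x) (λ _ _ c≢k c≡k → contradiction c≡k c≢k)
                  k refl
      ; χ-H   = transpose-elim (λ c d → c ≢ k → χ d ∈ A i → c ∈ H) j k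
                  (λ _ χk∈Ai → contradiction (subst (_∈ A i) χk≡z χk∈Ai) z∉Ai)
                  (λ _ k≢k → contradiction refl k≢k) (λ c c≢j _ _ → χ-H c c≢j)
      ; j∈U   = x∈p∧x≢y⇒x∈p-y k∈U k≢j
      ; left  = transpose-elim (λ c d → (c ∈ U - j → c ≡ k) → χ d ∈ X × (χ d ≡ z ⊎ transpose i j (φ (χ d)) ∉ U - j)) j k
                  (λ _ → subst (_∈ X) (sym χk≡z) z∈X , inj₁ χk≡z)
                  (λ _ _ → weaken (left j (const refl)))
                  (λ c c≢j c≢k h → weaken (left c λ c∈U → contradiction (h (x∈p∧x≢y⇒x∈p-y c∈U c≢j)) c≢k))
      }
      where
      z∈Aj : z ∈ A j
      z∈Aj = subst (λ c → z ∈ A c) φz≡j (φ-mem z z∈X (occupied≢u φz≡j))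
      z∈Aj' : χ k ∈ A j
      z∈Aj' = subst (_∈ A j) (sym χk≡z) z∈Aj
      k≢j : k ≢ j
      k≢j refl = z∉Ai (subst (_∈ A i) (trans (sym χj≡x) χk≡z) x∈Ai)
      -- The path never returns to an index it has left: `left` at such a `k` would make `z` equal
      -- to `u` or put its index `j` outside `U`.
      k∈U : k ∈ U
      k∈U with k ∈? U
      ... | yes k∈U = k∈U
      ... | no  k∉U with proj₂ (left k (λ k∈U → contradiction k∈U k∉U))
      ...   | inj₁ χk≡u = contradiction (trans (sym χk≡z) χk≡u) (occupied≢u φz≡j)
      ...   | inj₂ ∉U   = contradiction (subst (_∈ U) (trans (sym φz≡j) (cong φ (sym χk≡z))) j∈U) ∉U
      weaken : ∀ {w} → w ∈ X × (w ≡ u ⊎ φ w ∉ U) → w ∈ X × (w ≡ z ⊎ transpose i j (φ w) ∉ U - j)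
      weaken (w∈X , inj₁ w≡u) = w∈X , inj₂ (subst (_∉ U - j) (proj₁ (moved w∈X) w≡u) (x∉p-x U j))
      weaken {w} (w∈X , inj₂ φw∉U) with w ≟ u
      ... | yes w≡u = weaken (w∈X , inj₁ w≡u)
      ... | no  w≢u = w∈X , inj₂ (subst (_∉ U - j)
              (proj₂ (moved w∈X) w≢u (λ φw≡j → φw∉U (subst (_∈ U) (sym φw≡j) j∈U))) (φw∉U ∘ p-x⊆p U j))

  augment : (∀ χ → SDR A χ → (∀ k → χ k ∈ A i → k ∈ H) → ⊥) →
            ∀ U → Acc _⊂_ U → ∀ {φ χ j u} → Alternating A i x H X U φ χ j u → ∃ (Matching (delete A i x) X)
  augment noSDR U (acc rs) {φ} {χ} {j} {u} st with any? (λ z → (z ∈? X) ×-dec (φ z ≟ j))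
  ... | no free = _ , moved-matching st (λ z z∈X φz≡j → contradiction (z , z∈X , φz≡j) free)
  ... | yes (z , z∈X , φz≡j) with z ∈? A i
  ...   | yes z∈Ai = _ , moved-matching st λ w w∈X φw≡j →
            subst (λ v → v ∈ A i × v ≢ x) (φ-inj z w z∈X w∈X (trans φz≡j (sym φw≡j))) (z∈Ai , occupier≢x st z∈X φz≡j)
    where open Alternating st
  ...   | no z∉Ai with any? (λ k → χ k ≟ z)
  ...     | yes (k , χk≡z) = augment noSDR (U - j) (rs (x∈p⇒p-x⊂p j∈U)) (advance st z∈X φz≡j z∉Ai χk≡z)
    where open Alternating st
  ...     | no unused = ⊥-elim (noSDR (updateAt χ j (const z))
              (updateAt-SDR A χ-inj χ-mem (subst (λ c → z ∈ A c) φz≡j (φ-mem z z∈X (occupied≢u st φz≡j)))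
                (λ k _ χk≡z → unused (k , χk≡z)))
              (updateAt-elim (λ k v → v ∈ A i → k ∈ H) χ j (λ z∈Ai → contradiction z∈Ai z∉Ai) χ-H))
    where open Alternating st

≼-delete : (A : Family n r) {i j : Fin r} {x : Fin n} {H : Subset r} {ψ : Fin r → Fin n} →
           SDR A ψ → ψ j ≡ x → j ≢ i → x ∈ A i → (∀ k → k ≢ j → ψ k ∈ A i → k ∈ H) →
           (∀ χ → SDR A χ → (∀ k → χ k ∈ A i → k ∈ H) → ⊥) →
           A ≼ delete A i x
≼-delete A {i} {j} {x} {H} {ψ} (ψ-inj , ψ-mem) ψj≡x j≢i x∈Ai ψ-H noSDR X pt with transversal⇒matching A i pt
... | φ , φ-inj , φ-mem with x ∈? X | φ x ≟ i
... | no x∉X | _ = matching⇒transversal (delete A i x) (φ-inj , λ v v∈X →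
        ∈-delete A i _ (φ-mem v v∈X) λ _ v≡x → x∉X (subst (_∈ X) v≡x v∈X))
... | yes _ | no φx≢i = matching⇒transversal (delete A i x) (φ-inj , λ v v∈X →
        ∈-delete A i _ (φ-mem v v∈X) λ φv≡i v≡x → φx≢i (trans (cong φ (sym v≡x)) φv≡i))
-- The path starts with `x` misplaced in both matchings. As `U` is everything, `left` concerns only
-- `j`, whose representative is `x`.
... | yes x∈X | yes φx≡i = matching⇒transversal (delete A i x) (proj₂ (augment A i x H x∈Ai X noSDR ⊤ (⊂-wellFounded ⊤) (record
  { φ-inj = φ-inj
  ; φ-mem = λ v v∈X _ → φ-mem v v∈X
  ; u∈X   = x∈X
  ; φu≡i  = φx≡i
  ; u∈Aj  = subst (_∈ A j) ψj≡x (ψ-mem j)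
  ; j≢i   = j≢i
  ; χ-inj = ψ-inj
  ; χ-mem = λ k _ → ψ-mem k
  ; χj≡x  = ψj≡x
  ; χ-H   = ψ-H
  ; j∈U   = ∈⊤
  ; left  = λ k h → subst (λ k → ψ k ∈ X × (ψ k ≡ x ⊎ φ (ψ k) ∉ ⊤)) (sym (h ∈⊤))
              (subst (_∈ X) (sym ψj≡x) x∈X , inj₁ ψj≡x)
  })))

-- Cocircuits

interval-nonempty : {σ : Permutation′ n} {B : Subset n} → IsInterval σ B → ∃[ f ] f ∈ B
interval-nonempty {σ = σ} {B} (f , start) = f , start∈ σ B start

-- Intervals with a common first element are nested, so in an antichain the first elements are
-- distinct.
firstElements-SDR : (σ : Permutation′ n) (A : Family n r) → (∀ k → IsInterval σ (A k)) → IsAntichain A → ∃ (SDR A)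
firstElements-SDR σ A iv antichain = (λ k → proj₁ (iv k)) , inj , λ k → start∈ σ (A k) (proj₂ (iv k))
  where
  inj : Injective _≡_ _≡_ (λ k → proj₁ (iv k))
  inj {k} {l} eq with k ≟ l
  ... | yes k≡l = k≡l
  ... | no  k≢l with startsAt-nested σ (A k) (A l) (proj₂ (iv k)) (subst (StartsAt σ (A l)) (sym eq) (proj₂ (iv l)))
  ...   | inj₁ k⊆l = ⊥-elim (antichain k l k≢l k⊆l)
  ...   | inj₂ l⊆k = ⊥-elim (antichain l k (≢-sym k≢l) l⊆k)

module _ {M : IndepPred n} {A : Family n r} (pres : IsPresentation M A) where

  -- A matching of a basis disjoint from `A i` leaves the index `i` free, so `f` could be added to
  -- the basis.
  presentation-meetsAllBases : ∀ i {f} → f ∈ A i → MeetsAllBases M (A i)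
  presentation-meetsAllBases i {f} f∈Ai B (MB , maximal) with any? (λ x → (x ∈? A i) ×-dec (x ∈? B))
  ... | yes found = found
  ... | no disjoint = contradiction (f , f∈Ai , subst (f ∈_) B∪f≡B (q⊆p∪q B ⁅ f ⁆ (x∈⁅x⁆ f))) disjoint
    where
    matching : ∃ (Matching A B)
    matching = transversal⇒matching A i (to (pres B) MB)
    φ : Fin n → Fin r
    φ = proj₁ matching
    φ-inj = proj₁ (proj₂ matching)
    φ-mem = proj₂ (proj₂ matching)
    φ≢i : ∀ v → v ∈ B → φ v ≢ i
    φ≢i v v∈B φv≡i = disjoint (v , subst (λ c → v ∈ A c) φv≡i (φ-mem v v∈B) , v∈B)
    B∪f : Subset n
    B∪f = B ∪ ⁅ f ⁆
    inB : ∀ {v} → v ∈ B∪f → v ≢ f → v ∈ B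
    inB {v} v∈ v≢f with x∈p∪q⁻ B ⁅ f ⁆ v∈
    ... | inj₁ v∈B  = v∈B
    ... | inj₂ v∈⁅f⁆ = contradiction (x∈⁅y⁆⇒x≡y f v∈⁅f⁆) v≢f
    φ' : Fin n → Fin r
    φ' = updateAt φ f (const i)
    extended : Matching A B∪f φ'
    extended =
      (λ v w v∈ w∈ → updateAt-elim (λ v c → v ∈ B∪f → c ≡ φ' w → v ≡ w) φ f
        (λ _ → updateAt-elim (λ w c → w ∈ B∪f → i ≡ c → f ≡ w) φ f (λ _ _ → refl)
          (λ w w≢f w∈ i≡ → contradiction (sym i≡) (φ≢i w (inB w∈ w≢f))) w w∈)
        (λ v v≢f v∈ → updateAt-elim (λ w c → w ∈ B∪f → φ v ≡ c → v ≡ w) φ f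
          (λ _ ≡i → contradiction ≡i (φ≢i v (inB v∈ v≢f)))
          (λ w w≢f w∈ → φ-inj v w (inB v∈ v≢f) (inB w∈ w≢f)) w w∈)
        v v∈) ,
      updateAt-elim (λ v c → v ∈ B∪f → v ∈ A c) φ f (λ _ → f∈Ai) (λ v v≢f v∈ → φ-mem v (inB v∈ v≢f))
    B∪f≡B : B∪f ≡ B
    B∪f≡B = maximal B∪f (from (pres B∪f) (matching⇒transversal A extended)) (p⊆p∪q ⁅ f ⁆)

  image-independent : ∀ {ψ} → SDR A ψ → M (image ψ)
  image-independent {ψ} (ψ-inj , ψ-mem) = from (pres (image ψ))
    ( (λ v v∈ → proj₁ (∈-image⁻ ψ v∈))
    , (λ v w v∈ w∈ eq → trans (sym (proj₂ (∈-image⁻ ψ v∈))) (trans (cong ψ eq) (proj₂ (∈-image⁻ ψ w∈))))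
    , (λ v v∈ → let (k , ψk≡v) = ∈-image⁻ ψ v∈ in subst (_∈ A k) ψk≡v (ψ-mem k)) )

  -- By pigeonhole: a matching of a proper superset would inject `r + 1` elements into `Fin r`. The
  -- index `i` only supplies a default value.
  image-basis : Fin r → ∀ {ψ} → SDR A ψ → IsBasis M (image ψ)
  image-basis i {ψ} sdr@(ψ-inj , _) = image-independent sdr , λ X MX im⊆X → ⊆-antisym (X⊆ X MX im⊆X) im⊆X
    where
    X⊆ : ∀ X → M X → image ψ ⊆ X → X ⊆ image ψ
    X⊆ X MX im⊆X {y} y∈X with y ∈? image ψ | transversal⇒matching A i (to (pres X) MX)
    ... | yes y∈ | _ = y∈
    ... | no  y∉ | φ , φ-inj , _ = contradiction
      (injective⇒≤ {f = (φ y) Vector.∷ (φ ∘ ψ)} (∷-injective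
        (λ k eq → y∉ (subst (_∈ image ψ) (φ-inj _ _ (ψ∈X k) y∈X eq) (∈-image⁺ ψ k)))
        (λ {k} {l} eq → ψ-inj (φ-inj _ _ (ψ∈X k) (ψ∈X l) eq)))) 1+n≰n
      where
      ψ∈X : ∀ k → ψ k ∈ X
      ψ∈X k = im⊆X (∈-image⁺ ψ k)

  -- The `r` representatives form an independent set, so a matching of them into `A'` uses every
  -- index, including `i`.
  presentation-nonempty : ∀ {A'} → IsPresentation M A' → ∀ {ψ} → SDR A ψ → ∀ i → ∃[ f ] f ∈ A' i
  presentation-nonempty {A'} pres' {ψ} sdr i
    with any? (_∈? A' i) | transversal⇒matching A' i (to (pres' (image ψ)) (image-independent sdr))
  ... | yes found | _ = found
  ... | no empty  | φ , φ-inj , φ-mem = contradiction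
    (injective⇒≤ {f = i Vector.∷ (φ ∘ ψ)} (∷-injective
      (λ k φψk≡i → empty (ψ k , subst (λ c → ψ k ∈ A' c) φψk≡i (φ-mem (ψ k) (∈-image⁺ ψ k))))
      (λ {k} {l} eq → proj₁ sdr (φ-inj _ _ (∈-image⁺ ψ k) (∈-image⁺ ψ l) eq)))) 1+n≰n

-- Minimal interval presentations

module _ {M : IndepPred n} {σ : Permutation′ n} {I : Family n r}
         (min : IsMinimalIntervalPresentation σ M I) (i : Fin r) where
  private
    pres : IsPresentation M I
    pres = proj₁ (proj₁ min)
    interval : ∀ k → IsInterval σ (I k)
    interval = proj₁ (proj₂ (proj₁ min))
    antichain : IsAntichain I
    antichain = proj₂ (proj₂ (proj₁ min))

  AvoidingSDR : (Fin r → Fin n) → Set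
  AvoidingSDR ψ = SDR I ψ × (∀ k → k ≢ i → ψ k ∉ I i)

  -- Otherwise the family after the deletion could be repaired to a strictly smaller interval
  -- presentation. Taking `τ` to be `σ` or its inverse covers both ends of `I i`. The element shared
  -- with `I j` ensures that `I i` is not a singleton, as it would then lie within `I j`.
  end-not-deletable : (τ : Permutation′ n) →
    (∀ B → IsInterval σ B → IsInterval τ B) → (∀ B → IsInterval τ B → IsInterval σ B) →
    ∀ {j p} → j ≢ i → p ∉ I i → τ ⟨$⟩ʳ p ∈ I i → τ ⟨$⟩ʳ p ∈ I j → ¬ (I ≼ delete I i (τ ⟨$⟩ʳ p))
  end-not-deletable τ σ⇒τ τ⇒σ {j} {p} j≢i p∉Ii x∈Ii x∈Ij cov =
    let (I' , sub , cov' , interval' , antichain') = restoreAntichain τ (delete I i x) (<-wellFounded _) state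
        I'⊆I = λ k {v} (v∈ : v ∈ I' k) → delete⊆ I i x k (sub k v∈)
        pres' = λ X → mk⇔ (λ MX → cov' X (cov X (to (pres X) MX))) (λ pt → from (pres X) (⊆⇒≼ I'⊆I X pt))
        I'i≡Ii = proj₂ min I' (pres' , (λ k → τ⇒σ (I' k) (interval' k)) , antichain') I'⊆I i
    in ∉-delete I i x (sub i (subst (x ∈_) (sym I'i≡Ii) x∈Ii))
    where
    x : Fin n
    x = τ ⟨$⟩ʳ p
    shrunk : StartsAt τ (I i - x) (τ ⟨$⟩ʳ x)
    shrunk = interval-removeStart τ (I i) (σ⇒τ (I i) (interval i)) p∉Ii x∈Ii λ single →
      antichain i j (≢-sym j≢i) λ {w} w∈Ii → subst (_∈ I j) (sym (single w w∈Ii)) x∈Ij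
    keep : ∀ {k v} → k ≢ i → v ∈ delete I i x k → v ∈ I k
    keep {k} {v} k≢i = subst (v ∈_) (delete-≢ I i x k≢i)
    keep⁻ : ∀ {k v} → k ≢ i → v ∈ I k → v ∈ delete I i x k
    keep⁻ {k} {v} k≢i = subst (v ∈_) (sym (delete-≢ I i x k≢i))
    state : AlmostAntichain τ (delete I i x) i x
    state = record
      { interval   = updateAt-elim (λ _ → IsInterval τ) I i (_ , shrunk) (λ k _ → σ⇒τ (I k) (interval k))
      ; p∉Aj       = ∉-delete I i x
      ; τp∈Aj      = subst (τ ⟨$⟩ʳ x ∈_) (sym (delete-≡ I i x)) (start∈ τ (I i - x) shrunk)
      ; others     = λ k m k≢m k≢i m≢i sub → antichain k m k≢m (λ v∈ → keep m≢i (sub (keep⁻ k≢i v∈)))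
      ; notWithin  = λ k k≢i sub → antichain k i k≢i (λ v∈ → delete⊆ I i x i (sub (keep⁻ k≢i v∈)))
      ; p∉superset = λ k k≢i sub x∈ → antichain i k (≢-sym k≢i) λ {v} v∈ → superset k k≢i sub x∈ v v∈
      }
      where
      superset : ∀ k → k ≢ i → delete I i x i ⊆ delete I i x k → x ∈ delete I i x k → ∀ v → v ∈ I i → v ∈ I k
      superset k k≢i sub x∈ v v∈ with v ≟ x
      ... | yes refl = keep k≢i x∈
      ... | no v≢x   = keep k≢i (sub (∈-delete I i i v∈ (const v≢x)))

  -- `I j` meets `I i` and also leaves it, so it passes through an end of `I i`.
  crossing : ∀ {j y} → j ≢ i → y ∈ I j → y ∈ I i → ∃[ x ] x ∈ I j × x ∈ I i × ¬ (I ≼ delete I i x)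
  crossing {j} j≢i y∈Ij y∈Ii
    with ⊈⇒∃ (I j) (I i) (antichain j i j≢i)
  ... | z , z∈Ij , z∉Ii with interval-crossing σ (I j) (I i) (interval j) y∈Ij y∈Ii z∈Ij z∉Ii
  ...   | p , p∉ , inj₁ (∈Ij , ∈Ii) =
          _ , ∈Ij , ∈Ii , end-not-deletable σ (λ _ iv → iv) (λ _ iv → iv) j≢i p∉ ∈Ii ∈Ij
  ...   | p , p∉ , inj₂ (∈Ij , ∈Ii) =
          _ , ∈Ij , ∈Ii , end-not-deletable (flip σ) (interval-flip σ) (interval-flip (flip σ)) j≢i p∉ ∈Ii ∈Ij

  -- If x already represents I i, then I i and I j exchange their representatives.
  redirect : ∀ {ψ} → SDR I ψ → ∀ {j x} → j ≢ i → ψ j ∈ I i → x ∈ I j → x ∈ I i →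
    ∃[ ψ' ] ∃[ j' ] SDR I ψ' × j' ≢ i × ψ' j' ≡ x × ψ j' ∈ I i × (∀ k → k ≢ i → ψ' k ∈ I i → ψ k ∈ I i)
  redirect {ψ} sdr@(inj , mem) {j} {x} j≢i ψj∈Ii x∈Ij x∈Ii with any? (λ k → ψ k ≟ x)
  ... | no unused = updateAt ψ j (const x) , j , updateAt-SDR I inj (λ k _ → mem k) x∈Ij (λ k _ eq → unused (k , eq)) ,
          j≢i , updateAt-updates j ψ , ψj∈Ii ,
          updateAt-elim (λ k v → k ≢ i → v ∈ I i → ψ k ∈ I i) ψ j (λ _ _ → ψj∈Ii) (λ _ _ _ v∈ → v∈)
  ... | yes (l , ψl≡x) with l ≟ i
  ...   | no l≢i = ψ , l , sdr , l≢i , ψl≡x , subst (_∈ I i) (sym ψl≡x) x∈Ii , λ _ _ v∈ → v∈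
  ...   | yes refl = ψ ∘ transpose j i , j ,
          ((λ eq → transpose-injective j i (inj eq)) ,
           transpose-elim (λ c d → ψ d ∈ I c) j i (subst (_∈ I j) (sym ψl≡x) x∈Ij) (λ _ → ψj∈Ii) (λ c _ _ → mem c)) ,
          j≢i ,
          transpose-elim (λ c d → c ≡ j → ψ d ≡ x) j i (λ _ → ψl≡x) (λ i≢j i≡j → contradiction i≡j i≢j)
            (λ _ c≢j _ c≡j → contradiction c≡j c≢j) j refl ,
          ψj∈Ii ,
          transpose-elim (λ c d → c ≢ i → ψ d ∈ I i → ψ c ∈ I i) j i (λ _ _ → ψj∈Ii)
            (λ _ i≢i → contradiction refl i≢i) (λ _ _ _ _ v∈ → v∈)

  -- Minimising the number of representatives in `I i` becomes induction on a set `K` of indices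
  -- allowed to have them. The negated form fits `≼-delete`, which takes the absence of a better SDR
  -- as a hypothesis.
  avoidingSDR-exists : ¬ (∀ ψ → ¬ AvoidingSDR ψ)
  avoidingSDR-exists none =
    let (ψ , sdr) = firstElements-SDR σ I interval antichain in go ⊤ (⊂-wellFounded ⊤) ∈⊤ ψ sdr (λ _ _ _ → ∈⊤)
    where
    go : ∀ K → Acc _⊂_ K → i ∈ K → ∀ ψ → SDR I ψ → (∀ k → k ≢ i → ψ k ∈ I i → k ∈ K) → ⊥
    go K (acc rs) i∈K ψ sdr ψ-K with any? (λ k → ¬? (k ≟ i) ×-dec (ψ k ∈? I i))
    ... | no avoids = none ψ (sdr , λ k k≢i ψk∈ → avoids (k , k≢i , ψk∈))
    ... | yes (j , j≢i , ψj∈Ii) with crossing j≢i (proj₂ sdr j) ψj∈Ii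
    ...   | x , x∈Ij , x∈Ii , ¬deletable with redirect sdr j≢i ψj∈Ii x∈Ij x∈Ii
    ...     | ψ' , j' , sdr' , j'≢i , ψ'j'≡x , ψj'∈Ii , ψ'-ψ =
              -- `redirect` brings no new index into `I i`, and `j'` was already in `K`, so `K - j'`
              -- is a proper subset to which the induction applies.
              ¬deletable (≼-delete I {H = K - j'} sdr' ψ'j'≡x j'≢i x∈Ii ψ'-H noSDR)
      where
      i∈H : i ∈ K - j'
      i∈H = x∈p∧x≢y⇒x∈p-y i∈K (≢-sym j'≢i)
      ψ'-H : ∀ k → k ≢ j' → ψ' k ∈ I i → k ∈ K - j'
      ψ'-H k k≢j' ψ'k∈ with k ≟ i
      ... | yes refl = i∈H
      ... | no k≢i   = x∈p∧x≢y⇒x∈p-y (ψ-K k k≢i (ψ'-ψ k k≢i ψ'k∈)) k≢j'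
      noSDR : ∀ χ → SDR I χ → (∀ k → χ k ∈ I i → k ∈ K - j') → ⊥
      noSDR χ sdrχ χ-H = go (K - j') (rs (x∈p⇒p-x⊂p (ψ-K j' j'≢i ψj'∈Ii))) i∈H χ sdrχ (λ k _ → χ-H k)

  -- Letting any `x` of `I i` represent `I i` in an avoiding SDR gives a basis that meets `I i` in
  -- `x` alone. A subset of `I i` meeting all bases must therefore contain every such `x`.
  interval-cocircuit : IsCocircuit M (I i)
  interval-cocircuit =
    presentation-meetsAllBases pres i (proj₂ (interval-nonempty (interval i))) ,
    λ D D⊆Ii meets → ⊆-antisym D⊆Ii (Ii⊆ D D⊆Ii meets)
    where
    Ii⊆ : ∀ D → D ⊆ I i → MeetsAllBases M D → I i ⊆ D
    Ii⊆ D D⊆Ii meets {x} x∈Ii with x ∈? D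
    ... | yes x∈D = x∈D
    ... | no  x∉D = contradiction noAvoidingSDR avoidingSDR-exists
      where
      noAvoidingSDR : ∀ ψ → ¬ AvoidingSDR ψ
      noAvoidingSDR ψ ((inj , mem) , avoids) with meets (image ψ') (image-basis pres i
          (updateAt-SDR I inj (λ k _ → mem k) x∈Ii (λ k k≢i ψk≡x → avoids k k≢i (subst (_∈ I i) (sym ψk≡x) x∈Ii))))
        where
        ψ' : Fin r → Fin n
        ψ' = updateAt ψ i (const x)
      ... | v , v∈D , v∈image with ∈-image⁻ (updateAt ψ i (const x)) v∈image
      ...   | k , refl = updateAt-elim (λ k w → w ∉ D) ψ i x∉D (λ k k≢i w∈D → avoids k k≢i (D⊆Ii w∈D)) k v∈D

theorem6p4 : ∀ {n r : ℕ} (M : IndepPred n) (σ : Permutation′ n) (I : Family n r) →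
    IsMultiPath M → IsCyclic σ → IsMinimalIntervalPresentation σ M I →
    (∀ i → IsCocircuit M (I i)) × IsMinimalPresentation M I
theorem6p4 M σ I _ _ min@((pres , interval , antichain) , _) =
  interval-cocircuit min ,
  -- Each `A' i` is nonempty and so meets every basis; inside the cocircuit `I i` this forces
  -- equality.
  pres , λ A' pres' A'⊆I i →
    let (_ , sdr) = firstElements-SDR σ I interval antichain
        (_ , f∈)  = presentation-nonempty pres pres' sdr i
    in proj₂ (interval-cocircuit min i) (A' i) (A'⊆I i) (presentation-meetsAllBases pres' i f∈)
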